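{- Let $G$ be a finite (not necessarily abelian) group, written multiplicatively, and let $p(G)$ be the smallest prime dividing the order of $G$. Let $A, B \subseteq G$ with $|A| = k$ and $|B| = l$, where $k, l \geq 3$, and suppose that $p(G) > k + l - 2$. Suppose further that $A$ is a right geometric progression and $B$ is a left geometric progression with the same common ratio, i.e. there are $a, b, d \in G$ with $$A = \{a d^s \mid 0 \le s \le k-1\}, \qquad B = \{d^t b \mid 0 \le t \le l-1\}.$$ If $|A \overset{\iota}{\cdot} B| = |A| + |B| - 3$, then $A$ and $B$ have the same endpoints, i.e. $a = b$ and $a d^{k-1} = d^{l-1} b$.
   Context: For subsets $A, B$ of a group $G$, the restricted product set (with respect to the identity automorphism $\iota$) is $A \overset{\iota}{\cdot} B := \{ab \mid a \in A,\ b \in B,\ a \neq b\}$. The endpoints of the right progression $A = \{a d^s \mid 0 \le s \le k-1\}$ are its first endpoint $a$ and last endpoint $a d^{k-1}$; the endpoints of the left progression $B = \{d^t b \mid 0 \le t \le l-1\}$ are its first endpoint $b$ and last endpoint $d^{l-1} b$. "Same endpoints" means that the first endpoints coincide and the last endpoints coincide. -}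

module Defs where

open import Algebra.Bundles using (Group)
open import Data.Fin.Properties using (≡-setoid)
open import Data.Nat.Base using (ℕ; _≤_; _<_)
open import Data.Nat.Divisibility using (_∣_)
open import Data.Nat.Primality using (Prime)
open import Data.Product.Base using (Σ; _×_; ∃-syntax; proj₁)
open import Function.Bundles using (Inverse)
open import Level using (Level; _⊔_)
open import Relation.Binary.Bundles using (Setoid)
import Relation.Binary.Construct.On as On
open import Relation.Unary using (Pred)

record IsSmallestPrimeDivisor (p n : ℕ) : Set where
  field
    prime   : Prime p
    divides : p ∣ n
    least   : ∀ {q} → Prime q → q ∣ n → p ≤ q

HasCardinality : {c ℓ : Level} → Setoid c ℓ → ℕ → Set (c ⊔ ℓ)
HasCardinality S n = Inverse S (≡-setoid n)

module GroupSubsets {c ℓ : Level} (G : Group c ℓ) where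

  open Group G
  import Algebra.Definitions.RawMonoid rawMonoid as Mult

  infixr 8 _^_

  -- The library writes iteration of a monoid operation additively.
  _^_ : Carrier → ℕ → Carrier
  x ^ n = n Mult.× x

  -- Elements of a subset are compared with the equality of the group, so
  -- membership proofs are not counted.
  subsetSetoid : {ℓ′ : Level} → Pred Carrier ℓ′ → Setoid (c ⊔ ℓ′) ℓ
  subsetSetoid A = On.setoid {B = Σ Carrier A} setoid proj₁

  RightProgression : (a d : Carrier) (k : ℕ) → Pred Carrier ℓ
  RightProgression a d k x = ∃[ s ] (s < k × x ≈ a ∙ (d ^ s))

  LeftProgression : (d b : Carrier) (l : ℕ) → Pred Carrier ℓ
  LeftProgression d b l x = ∃[ t ] (t < l × x ≈ (d ^ t) ∙ b)

  RestrictedProduct : {ℓ₁ ℓ₂ : Level} → Pred Carrier ℓ₁ → Pred Carrier ℓ₂ →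
                      Pred Carrier (c ⊔ ℓ ⊔ ℓ₁ ⊔ ℓ₂)
  RestrictedProduct A B x =
    ∃[ a ] ∃[ b ] (A a × B b × a ≉ b × x ≈ a ∙ b)

{-# OPTIONS --safe #-}

-- The products of elements of A and B are the a dᵐ b with 0 ≤ m ≤ k + l − 2.  As d ≠ 1 and
-- p(G) > k + l − 2, these are pairwise distinct, so the restricted product misses exactly two of
-- them.  If it misses an interior m, then (a dˢ⁺¹ , dᵗ b) and (a dˢ , dᵗ⁺¹ b) are pairs of equal
-- elements for some s + t = m − 1, which forces d b d = b.  Then d commutes with b², and as b has
-- odd order this gives d² = 1, contradicting p(G) > 2.  Hence the two missing products are those
-- of the first endpoints and of the last endpoints.

module Submission where

open import Defs
open import Algebra.Bundles using (Group)
import Algebra.Properties.Group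
import Algebra.Properties.Monoid.Mult
open import Data.Fin.Base using (Fin; zero; suc; toℕ)
import Data.Fin.Properties as Fin
open import Data.List.Base using (List; []; _∷_; _++_; length; lookup; applyUpTo)
open import Data.List.Membership.Propositional using (_∈_)
open import Data.List.Membership.Propositional.Properties
  using (∈-lookup; ∈-applyUpTo⁺; ∈-applyUpTo⁻; ∈-++⁺ˡ; ∈-++⁺ʳ; ∈-++⁻)
import Data.List.Membership.DecPropositional as DecMembership
import Data.List.Membership.Setoid.Properties as Membershipₛ
open import Data.List.Properties using (length-++; length-applyUpTo)
open import Data.List.Relation.Unary.All as All using (_∷_)
open import Data.List.Relation.Unary.AllPairs using ([]; _∷_)
open import Data.List.Relation.Unary.Any using (index)
open import Data.List.Relation.Unary.Unique.Propositional using (Unique)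
open import Data.List.Relation.Unary.Unique.Propositional.Properties using (++⁺; applyUpTo⁺₁)
open import Data.Nat.Base hiding (_^_)
open import Data.Nat.DivMod using (_divMod_; result)
open import Data.Nat.Divisibility
  using (_∣_; divides; ∣⇒≤; ∣-refl; ∣-trans; ∣m∣n⇒∣m+n; m∣m*n; _∣0)
open import Data.Nat.GeneralisedArithmetic using (fold; fold-+)
open import Data.Nat.Induction using (<-rec)
open import Data.Nat.ListAction using (product)
open import Data.Nat.Primality using (Prime; prime[2])
open import Data.Nat.Primality.Factorisation using (PrimeFactorisation; factorise)
open import Data.Nat.Properties
open import Data.Product.Base using (_×_; _,_; ∃; ∃₂; proj₁; proj₂)
open import Data.Sum.Base using (inj₁; inj₂)
open import Function.Bundles using (Inverse)
open import Function.Definitions using (Injective)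
open import Level using (Level)
import Relation.Binary.PropositionalEquality as ≡
open ≡ using (_≡_; _≢_; refl; cong; subst)
import Relation.Binary.Reasoning.Setoid as SetoidReasoning
open import Relation.Binary.Definitions using (Decidable)
open import Relation.Nullary using (¬_; yes; no; contradiction)
open import Relation.Nullary.Decidable using (map′; _×-dec_; decidable-stable)
open import Relation.Unary using (Pred; _≐_)

-- Counting with lists over `Fin n`.

unique⇒lookup-injective : ∀ {a} {A : Set a} {xs : List A} → Unique xs →
                          Injective _≡_ _≡_ (lookup xs)
unique⇒lookup-injective (_ ∷ _)    {zero}  {zero}  _  = refl
unique⇒lookup-injective (x∉xs ∷ _) {zero}  {suc j} eq =
  contradiction eq (All.lookup x∉xs (∈-lookup j))
unique⇒lookup-injective (x∉xs ∷ _) {suc i} {zero}  eq =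
  contradiction (≡.sym eq) (All.lookup x∉xs (∈-lookup i))
unique⇒lookup-injective (_ ∷ xs!)  {suc i} {suc j} eq =
  cong suc (unique⇒lookup-injective xs! eq)

unique⇒length≤ : ∀ {n} {xs : List (Fin n)} → Unique xs → length xs ≤ n
unique⇒length≤ xs! = Fin.injective⇒≤ (unique⇒lookup-injective xs!)

complete⇒length≥ : ∀ {n} {xs : List (Fin n)} → (∀ i → i ∈ xs) → n ≤ length xs
complete⇒length≥ {n} all∈ = Fin.injective⇒≤ {f = λ i → index (all∈ i)} λ {i} {j} →
  Membershipₛ.index-injective (≡.setoid (Fin n)) (all∈ i) (all∈ j)

-- Self-maps of a finite set whose cycles all have length `m`.

module _ {n m : ℕ} (f : Fin n → Fin n) (0<m : 0 < m)
         (periodic : ∀ i → fold i f m ≡ i)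
         (free : ∀ i j → 0 < j → j < m → fold i f j ≢ i) where

  open DecMembership (Fin._≟_ {n}) using (_∈?_)

  private
    orbit : Fin n → List (Fin n)
    orbit i = applyUpTo (fold i f) m

    Closed : List (Fin n) → Set
    Closed xs = ∀ {i} → i ∈ xs → f i ∈ xs

    orbit-closed : ∀ i → Closed (orbit i)
    orbit-closed i j∈ with ∈-applyUpTo⁻ (fold i f) j∈
    ... | e , e<m , refl with m≤n⇒m<n∨m≡n e<m
    ... | inj₁ 1+e<m = ∈-applyUpTo⁺ (fold i f) 1+e<m
    ... | inj₂ refl  = subst (_∈ orbit i) (≡.sym (periodic i)) (∈-applyUpTo⁺ (fold i f) 0<m)

    -- A repetition at positions `e < e′` would make `fold i f e` return to itself after `e′ ∸ e`
    -- steps, a positive number below `m`, against `free`.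
    orbit-unique : ∀ i → Unique (orbit i)
    orbit-unique i = applyUpTo⁺₁ (fold i f) m λ {e} {e′} e<e′ e′<m eq →
      free (fold i f e) (e′ ∸ e) (m<n⇒0<n∸m e<e′) (≤-<-trans (m∸n≤m e′ e) e′<m)
        (≡.trans (≡.sym (fold-+ i f (e′ ∸ e)))
          (≡.trans (cong (fold i f) (m∸n+n≡m (<⇒≤ e<e′))) (≡.sym eq)))

    fold-closed : ∀ {xs} → Closed xs → ∀ {i} → i ∈ xs → ∀ e → fold i f e ∈ xs
    fold-closed closed i∈ zero    = i∈
    fold-closed closed i∈ (suc e) = closed (fold-closed closed i∈ e)

    -- After `e` steps, another `m ∸ e` lead back to `i`. Hence the orbit of a point outside a
    -- closed list stays disjoint from that list.
    orbit-exit : ∀ {xs} → Closed xs → ∀ {i e} → e < m → fold i f e ∈ xs → i ∈ xs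
    orbit-exit closed {i} {e} e<m fᵉi∈ = subst (_∈ _)
      (≡.trans (≡.sym (fold-+ i f (m ∸ e)))
        (≡.trans (cong (fold i f) (m∸n+n≡m (<⇒≤ e<m))) (periodic i)))
      (fold-closed closed fᵉi∈ (m ∸ e))

    -- Whole orbits are adjoined until `Fin n` is covered, so the length stays a multiple of `m`.
    -- Each orbit adds at least one element while `fuel` drops by one, which preserves
    -- `n < fuel + length xs`; at zero fuel this would give a repetition-free list longer than `n`.
    adjoin-orbits : ∀ fuel xs → n < fuel + length xs → Unique xs → Closed xs →
                    m ∣ length xs → m ∣ n
    adjoin-orbits zero xs n< xs! closed m∣ = contradiction (unique⇒length≤ xs!) (<⇒≱ n<)
    adjoin-orbits (suc fuel) xs n< xs! closed m∣ with Fin.all? (_∈? xs)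
    ... | yes all∈ = subst (m ∣_) (≤-antisym (unique⇒length≤ xs!) (complete⇒length≥ all∈)) m∣
    ... | no ¬all∈ with Fin.¬∀⟶∃¬ n (_∈ xs) (_∈? xs) ¬all∈
    ... | i , i∉ = adjoin-orbits fuel (orbit i ++ xs) n<′
          (++⁺ (orbit-unique i) xs! disjoint) closed′
          (subst (m ∣_) (≡.sym len) (∣m∣n⇒∣m+n ∣-refl m∣))
      where
      len : length (orbit i ++ xs) ≡ m + length xs
      len = ≡.trans (length-++ (orbit i))
              (cong (_+ length xs) (length-applyUpTo (fold i f) m))

      n<′ : n < fuel + length (orbit i ++ xs)
      n<′ = begin-strict
        n                               <⟨ n< ⟩
        suc fuel + length xs            ≡⟨ +-suc fuel (length xs) ⟨
        fuel + (1 + length xs)          ≤⟨ +-monoʳ-≤ fuel (+-monoˡ-≤ (length xs) 0<m) ⟩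
        fuel + (m + length xs)          ≡⟨ cong (fuel +_) len ⟨
        fuel + length (orbit i ++ xs)   ∎
        where open ≤-Reasoning

      disjoint : ∀ {j} → ¬ (j ∈ orbit i × j ∈ xs)
      disjoint (j∈orbit , j∈xs) with ∈-applyUpTo⁻ (fold i f) j∈orbit
      ... | _ , e<m , refl = i∉ (orbit-exit closed e<m j∈xs)

      closed′ : Closed (orbit i ++ xs)
      closed′ j∈ with ∈-++⁻ (orbit i) j∈
      ... | inj₁ j∈orbit = ∈-++⁺ˡ (orbit-closed i j∈orbit)
      ... | inj₂ j∈xs    = ∈-++⁺ʳ (orbit i) (closed j∈xs)

  free-period∣card : m ∣ n
  free-period∣card =
    adjoin-orbits (suc n) [] (m≤m+n (suc n) 0) [] (λ ()) (m ∣0)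

-- Divisors of naturals.

primeDivisor : ∀ m → 1 < m → ∃ λ q → Prime q × q ∣ m
primeDivisor m 1<m = go (factorise m)
  where
  instance _ = >-nonZero (<-trans z<s 1<m)
  go : PrimeFactorisation m → ∃ λ q → Prime q × q ∣ m
  go record { factors = [] ; isFactorisation = m≡1 } = contradiction m≡1 (>⇒≢ 1<m)
  go record { factors = q ∷ qs ; isFactorisation = refl ; factorsPrime = q-prime ∷ _ } =
    q , q-prime , m∣m*n (product qs)

-- If `m` exceeded 1, a prime factor of it would be a prime divisor of `n` below `p`.
divisor<smallestPrime⇒≡1 : ∀ {p n m} → IsSmallestPrimeDivisor p n →
                           0 < m → m ∣ n → m < p → m ≡ 1
divisor<smallestPrime⇒≡1 {m = m} p-least 0<m m∣n m<p with m≤n⇒m<n∨m≡n 0<m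
... | inj₂ 1≡m = ≡.sym 1≡m
... | inj₁ 1<m with primeDivisor m 1<m
... | q , q-prime , q∣m = contradiction
      (≤-trans (IsSmallestPrimeDivisor.least p-least q-prime (∣-trans q∣m m∣n)) (∣⇒≤ q∣m))
      (<⇒≱ m<p)
  where instance _ = >-nonZero 0<m

split-≤-+ : ∀ u v {m} → m ≤ u + v → ∃₂ λ s t → s ≤ u × t ≤ v × s + t ≡ m
split-≤-+ u v {m} m≤u+v with m ≤? u
... | yes m≤u = m , 0 , m≤u , z≤n , +-identityʳ m
... | no  m≰u = u , m ∸ u , ≤-refl , m≤n+o⇒m∸n≤o m u m≤u+v , m+[n∸m]≡n (≰⇒≥ m≰u)

-- Powers and the relation `y ∙ x ∙ y ≈ x` in a group.

module _ {c ℓ : Level} (G : Group c ℓ) where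

  open Group G renaming (refl to ≈-refl; sym to ≈-sym; trans to ≈-trans)
  open GroupSubsets G
  open Algebra.Properties.Group G using (∙-cancelˡ; ∙-cancelʳ; identityˡ-unique)
  open Algebra.Properties.Monoid.Mult monoid
    using (×-homo-+; ×-homo-1; ×-assocˡ; ×-congˡ)

  private module ≈-Reasoning = SetoidReasoning setoid

  ^-sucʳ : ∀ x m → x ^ suc m ≈ x ^ m ∙ x
  ^-sucʳ x m = begin
    x ^ suc m     ≈⟨ ×-congˡ (+-comm 1 m) ⟩
    x ^ (m + 1)   ≈⟨ ×-homo-+ x m 1 ⟩
    x ^ m ∙ x ^ 1 ≈⟨ ∙-congˡ (×-homo-1 x) ⟩
    x ^ m ∙ x     ∎
    where open ≈-Reasoning

  ε-^ : ∀ {x} m → x ≈ ε → x ^ m ≈ ε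
  ε-^ zero    x≈ε = ≈-refl
  ε-^ (suc m) x≈ε = ≈-trans (∙-cong x≈ε (ε-^ m x≈ε)) (identityˡ ε)

  ^-≈⇒^-∸≈ε : ∀ x {i j} → i ≤ j → x ^ i ≈ x ^ j → x ^ (j ∸ i) ≈ ε
  ^-≈⇒^-∸≈ε x {i} {j} i≤j eq = identityˡ-unique (x ^ (j ∸ i)) (x ^ i) (begin
    x ^ (j ∸ i) ∙ x ^ i ≈⟨ ×-homo-+ x (j ∸ i) i ⟨
    x ^ (j ∸ i + i)     ≈⟨ ×-congˡ (m∸n+n≡m i≤j) ⟩
    x ^ j               ≈⟨ eq ⟨
    x ^ i               ∎)
    where open ≈-Reasoning

  ^-commute : ∀ {x y} → x ∙ y ≈ y ∙ x → ∀ m → x ∙ y ^ m ≈ y ^ m ∙ x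
  ^-commute {x} comm zero = ≈-trans (identityʳ x) (≈-sym (identityˡ x))
  ^-commute {x} {y} comm (suc m) = begin
    x ∙ (y ∙ y ^ m) ≈⟨ assoc x y (y ^ m) ⟨
    x ∙ y ∙ y ^ m   ≈⟨ ∙-congʳ comm ⟩
    y ∙ x ∙ y ^ m   ≈⟨ assoc y x (y ^ m) ⟩
    y ∙ (x ∙ y ^ m) ≈⟨ ∙-congˡ (^-commute comm m) ⟩
    y ∙ (y ^ m ∙ x) ≈⟨ assoc y (y ^ m) x ⟨
    y ∙ y ^ m ∙ x   ∎
    where open ≈-Reasoning

  module _ {x y : Carrier} (yxy≈x : y ∙ x ∙ y ≈ x) where

    open ≈-Reasoning

    -- In `yxx` the last `x` is expanded to `yxy`; the first three factors of `yxyxy` then contract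
    -- to `x`, leaving `xxy`.
    inverted⇒commutes-with-square : y ∙ x ^ 2 ≈ x ^ 2 ∙ y
    inverted⇒commutes-with-square = begin
      y ∙ x ^ 2               ≈⟨ ∙-congˡ x²≈xx ⟩
      y ∙ (x ∙ x)             ≈⟨ assoc y x x ⟨
      y ∙ x ∙ x               ≈⟨ ∙-congˡ yxy≈x ⟨
      y ∙ x ∙ (y ∙ x ∙ y)     ≈⟨ ∙-congˡ (assoc y x y) ⟩
      y ∙ x ∙ (y ∙ (x ∙ y))   ≈⟨ assoc (y ∙ x) y (x ∙ y) ⟨
      y ∙ x ∙ y ∙ (x ∙ y)     ≈⟨ ∙-congʳ yxy≈x ⟩
      x ∙ (x ∙ y)             ≈⟨ assoc x x y ⟨
      x ∙ x ∙ y               ≈⟨ ∙-congʳ x²≈xx ⟨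
      x ^ 2 ∙ y               ∎
      where
      x²≈xx : x ^ 2 ≈ x ∙ x
      x²≈xx = ∙-congˡ (×-homo-1 x)

    -- The odd power is `w ∙ x` with `w` a power of `x ^ 2`, which commutes with `y`. So
    -- conjugation-like multiplication by `y` on both sides only acts on the factor `x` and fixes
    -- the odd power; as that power is `ε`, this reads `y ∙ y ≈ ε`.
    inverted-by-odd-order⇒involution : ∀ r → x ^ (1 + r * 2) ≈ ε → y ^ 2 ≈ ε
    inverted-by-odd-order⇒involution r x^≈ε = begin
      y ^ 2                   ≈⟨ ∙-congˡ (×-homo-1 y) ⟩
      y ∙ y                   ≈⟨ ∙-congʳ (identityʳ y) ⟨
      y ∙ ε ∙ y               ≈⟨ ∙-congʳ (∙-congˡ x^≈ε) ⟨
      y ∙ x ^ (1 + r * 2) ∙ y ≈⟨ ∙-congʳ (∙-congˡ odd) ⟩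
      y ∙ (w ∙ x) ∙ y         ≈⟨ ∙-congʳ (assoc y w x) ⟨
      y ∙ w ∙ x ∙ y           ≈⟨ ∙-congʳ (∙-congʳ (^-commute inverted⇒commutes-with-square r)) ⟩
      w ∙ y ∙ x ∙ y           ≈⟨ ∙-congʳ (assoc w y x) ⟩
      w ∙ (y ∙ x) ∙ y         ≈⟨ assoc w (y ∙ x) y ⟩
      w ∙ (y ∙ x ∙ y)         ≈⟨ ∙-congˡ yxy≈x ⟩
      w ∙ x                   ≈⟨ odd ⟨
      x ^ (1 + r * 2)         ≈⟨ x^≈ε ⟩
      ε                       ∎
      where
      w : Carrier
      w = (x ^ 2) ^ r
      odd : x ^ (1 + r * 2) ≈ w ∙ x
      odd = ≈-trans (^-sucʳ x (r * 2)) (∙-congʳ (≈-sym (×-assocˡ x r 2)))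

  -- Multiplying the second equation by `d` on the right turns its left side into that of the first;
  -- comparing the right sides and cancelling `d ^ t` eliminates `a`.
  two-representations⇒inverted : ∀ {a b d} s t → a ∙ d ^ suc s ≈ d ^ t ∙ b →
                                 a ∙ d ^ s ≈ d ^ suc t ∙ b → d ∙ b ∙ d ≈ b
  two-representations⇒inverted {a} {b} {d} s t eq₁ eq₂ =
    ∙-cancelˡ (d ^ t) (d ∙ b ∙ d) b (begin
      d ^ t ∙ (d ∙ b ∙ d) ≈⟨ assoc (d ^ t) (d ∙ b) d ⟨
      d ^ t ∙ (d ∙ b) ∙ d ≈⟨ ∙-congʳ (assoc (d ^ t) d b) ⟨
      d ^ t ∙ d ∙ b ∙ d   ≈⟨ ∙-congʳ (∙-congʳ (^-sucʳ d t)) ⟨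
      d ^ suc t ∙ b ∙ d   ≈⟨ ∙-congʳ eq₂ ⟨
      a ∙ d ^ s ∙ d       ≈⟨ assoc a (d ^ s) d ⟩
      a ∙ (d ^ s ∙ d)     ≈⟨ ∙-congˡ (^-sucʳ d s) ⟨
      a ∙ d ^ suc s       ≈⟨ eq₁ ⟩
      d ^ t ∙ b           ∎)
    where open ≈-Reasoning

  product-of-powers : ∀ a b d s t → a ∙ d ^ (s + t) ∙ b ≈ a ∙ d ^ s ∙ (d ^ t ∙ b)
  product-of-powers a b d s t = begin
    a ∙ d ^ (s + t) ∙ b       ≈⟨ ∙-congʳ (∙-congˡ (×-homo-+ d s t)) ⟩
    a ∙ (d ^ s ∙ d ^ t) ∙ b   ≈⟨ ∙-congʳ (assoc a (d ^ s) (d ^ t)) ⟨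
    a ∙ d ^ s ∙ d ^ t ∙ b     ≈⟨ assoc (a ∙ d ^ s) (d ^ t) b ⟩
    a ∙ d ^ s ∙ (d ^ t ∙ b)   ∎
    where open ≈-Reasoning

  -- Cardinalities of subsets.

  distinct-members⇒≤-card : ∀ {ℓ′} {P : Pred Carrier ℓ′} {M N} →
    HasCardinality (subsetSetoid P) N → (x : ℕ → Carrier) → (∀ {i} → i < M → P (x i)) →
    (∀ {i j} → i < j → j < M → x i ≉ x j) → M ≤ N
  distinct-members⇒≤-card {P = P} {M} {N} card x x∈P distinct with M ≤? N
  ... | yes M≤N = M≤N
  ... | no  M≰N with Fin.pigeonhole (≰⇒> M≰N) (λ i → to (x (toℕ i) , x∈P (Fin.toℕ<n i)))
    where open Inverse card
  ... | i , j , i<j , eq = contradiction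
        (≈-trans (≈-sym (strictlyInverseʳ _)) (≈-trans (from-cong eq) (strictlyInverseʳ _)))
        (distinct i<j (Fin.toℕ<n j))
    where open Inverse card

  -- With trivial ratio every member of `A` equals `a`, so the two distinct indices `zero` and
  -- `suc zero` would enumerate the same element.
  ratio≉ε : ∀ {ℓ′} {A : Pred Carrier ℓ′} {k a d} → HasCardinality (subsetSetoid A) (2+ k) →
            A ≐ RightProgression a d (2+ k) → d ≉ ε
  ratio≉ε {k = k} {a} {d} card A≐ d≈ε = contradiction 0≡1 λ ()
    where
    open Inverse card
    from≈a : ∀ i → proj₁ (from i) ≈ a
    from≈a i with proj₁ A≐ (proj₂ (from i))
    ... | s , _ , eq = ≈-trans eq (≈-trans (∙-congˡ (ε-^ s d≈ε)) (identityʳ a))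
    0≡1 : _≡_ {A = Fin (2+ k)} zero (suc zero)
    0≡1 = ≡.trans (≡.sym (strictlyInverseˡ zero))
            (≡.trans (to-cong (≈-trans (from≈a zero) (≈-sym (from≈a (suc zero)))))
              (strictlyInverseˡ (suc zero)))

  -- Orders of elements in a finite group.

  record IsOrder (x : Carrier) (m : ℕ) : Set ℓ where
    field
      positive : 0 < m
      ^-order  : x ^ m ≈ ε
      minimal  : ∀ j → 0 < j → j < m → x ^ j ≉ ε

  module _ {n : ℕ} (finite : HasCardinality setoid n) where

    open Inverse finite using (to; from; to-cong; from-cong; strictlyInverseˡ; strictlyInverseʳ)

    infix 4 _≈?_
    _≈?_ : Decidable _≈_
    x ≈? y = map′
      (λ eq → ≈-trans (≈-sym (strictlyInverseʳ x)) (≈-trans (from-cong eq) (strictlyInverseʳ y)))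
      to-cong (to x Fin.≟ to y)

    -- Descent to the least positive exponent: finiteness makes `_≈_` decidable, so smaller
    -- exponents can be searched. The bound `m ≤ i` is kept for comparison with `p`.
    order≤exponent : ∀ x i → 0 < i → x ^ i ≈ ε → ∃ λ m → m ≤ i × IsOrder x m
    order≤exponent x = <-rec _ go
      where
      go : ∀ i → (∀ {j} → j < i → 0 < j → x ^ j ≈ ε → ∃ λ m → m ≤ j × IsOrder x m) →
           0 < i → x ^ i ≈ ε → ∃ λ m → m ≤ i × IsOrder x m
      go i rec 0<i eq with anyUpTo? (λ j → (0 <? j) ×-dec (x ^ j ≈? ε)) i
      ... | yes (j , j<i , 0<j , eq′) =
            let m , m≤j , ord = rec j<i 0<j eq′ in m , ≤-trans m≤j (<⇒≤ j<i) , ord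
      ... | no none = i , ≤-refl , record
            { positive = 0<i
            ; ^-order  = eq
            ; minimal  = λ j 0<j j<i eq′ → none (j , j<i , 0<j , eq′)
            }

    -- Two of the `n + 1` powers with exponents `0` to `n` coincide, and the difference of their
    -- exponents kills `x`.
    order-exists : ∀ x → ∃ (IsOrder x)
    order-exists x with Fin.pigeonhole (n<1+n n) (λ i → to (x ^ toℕ i))
    ... | i , j , i<j , eq =
      let m , _ , ord = order≤exponent x (toℕ j ∸ toℕ i) (m<n⇒0<n∸m i<j)
                          (^-≈⇒^-∸≈ε x (<⇒≤ i<j)
                            (≈-trans (≈-sym (strictlyInverseʳ _))
                              (≈-trans (from-cong eq) (strictlyInverseʳ _))))
      in m , ord

    -- Lagrange's theorem for the subgroup generated by `x`. Left translation by `x`, carried over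
    -- to `Fin n`, has period `m`; returning to any point sooner would make a smaller positive power
    -- of `x` trivial.
    order∣card : ∀ {x m} → IsOrder x m → m ∣ n
    order∣card {x} {m} ord = free-period∣card translate positive
      (λ i → ≡.trans (≡.sym (strictlyInverseˡ _))
        (≡.trans (to-cong (≈-trans (from-fold i m) (≈-trans (∙-congʳ ^-order) (identityˡ _))))
          (strictlyInverseˡ i)))
      (λ i j 0<j j<m eq → minimal j 0<j j<m
        (identityˡ-unique (x ^ j) (from i) (≈-trans (≈-sym (from-fold i j)) (from-cong eq))))
      where
      open IsOrder ord
      translate : Fin n → Fin n
      translate i = to (x ∙ from i)
      from-fold : ∀ i j → from (fold i translate j) ≈ x ^ j ∙ from i
      from-fold i zero    = ≈-sym (identityˡ (from i))
      from-fold i (suc j) = begin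
        from (to (x ∙ from (fold i translate j))) ≈⟨ strictlyInverseʳ _ ⟩
        x ∙ from (fold i translate j)             ≈⟨ ∙-congˡ (from-fold i j) ⟩
        x ∙ (x ^ j ∙ from i)                      ≈⟨ assoc x (x ^ j) (from i) ⟨
        x ^ suc j ∙ from i                        ∎
        where open ≈-Reasoning

    module _ {p : ℕ} (p-least : IsSmallestPrimeDivisor p n) where

      small-exponent⇒≈ε : ∀ {x i} → 0 < i → i < p → x ^ i ≈ ε → x ≈ ε
      small-exponent⇒≈ε {x} 0<i i<p eq with order≤exponent x _ 0<i eq
      ... | m , m≤i , ord
        with divisor<smallestPrime⇒≡1 p-least (IsOrder.positive ord) (order∣card ord)
               (≤-<-trans m≤i i<p)
      ... | refl = ≈-trans (≈-sym (×-homo-1 x)) (IsOrder.^-order ord)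

      -- The order of `x` serves: were it even, 2 would be a prime divisor of `n` below `p`.
      odd-exponent : 2 < p → ∀ x → ∃ λ r → x ^ (1 + r * 2) ≈ ε
      odd-exponent 2<p x with order-exists x
      ... | m , ord with m divMod 2
      ... | result r (suc zero) refl = r , IsOrder.^-order ord
      ... | result r zero       eq   = contradiction
            (IsSmallestPrimeDivisor.least p-least prime[2]
              (∣-trans (divides r eq) (order∣card ord)))
            (<⇒≱ 2<p)

      inverted⇒≈ε : 2 < p → ∀ {x y} → y ∙ x ∙ y ≈ x → y ≈ ε
      inverted⇒≈ε 2<p {x} yxy≈x =
        let r , x^≈ε = odd-exponent 2<p x in
        small-exponent⇒≈ε z<s 2<p (inverted-by-odd-order⇒involution yxy≈x r x^≈ε)

      -- The restricted product of progressions of lengths `2 + u` and `2 + v`.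

      module _ {ℓ₁ ℓ₂ : Level} {A : Pred Carrier ℓ₁} {B : Pred Carrier ℓ₂} {u v : ℕ}
               (bound : 2 + (u + v) < p) {a b d : Carrier} (d≉ε : d ≉ ε)
               (A⊇ : ∀ {x} → RightProgression a d (2 + u) x → A x)
               (B⊇ : ∀ {x} → LeftProgression d b (2 + v) x → B x) where

        private
          AB : Pred Carrier _
          AB = RestrictedProduct A B

        product∈ : ∀ s t → s < 2 + u → t < 2 + v → a ∙ d ^ s ≉ d ^ t ∙ b →
                   AB (a ∙ d ^ (s + t) ∙ b)
        product∈ s t s< t< ≉ = a ∙ d ^ s , d ^ t ∙ b , A⊇ (s , s< , ≈-refl) ,
          B⊇ (t , t< , ≈-refl) , ≉ , product-of-powers a b d s t

        -- The exponent `suc m` splits both as `suc s + t` and as `s + suc t`, within the ranges of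
        -- both progressions. If the first pair consists of equal elements, the second cannot, since
        -- `d` would then be trivial.
        interior∈ : ∀ {m} → m ≤ u + v → AB (a ∙ d ^ suc m ∙ b)
        interior∈ m≤ with split-≤-+ u v m≤
        ... | s , t , s≤u , t≤v , refl with a ∙ d ^ suc s ≈? d ^ t ∙ b
        ... | no  ≉   = product∈ (suc s) t (s≤s (s≤s s≤u)) (s≤s (m≤n⇒m≤1+n t≤v)) ≉
        ... | yes eq₁ = subst (λ m → AB (a ∙ d ^ m ∙ b)) (+-suc s t)
              (product∈ s (suc t) (s≤s (m≤n⇒m≤1+n s≤u)) (s≤s (s≤s t≤v)) λ eq₂ →
                d≉ε (inverted⇒≈ε (≤-trans (s≤s (m≤m+n 2 (u + v))) bound)
                  (two-representations⇒inverted s t eq₁ eq₂)))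

        -- The offset `e` lets one statement cover the exponents starting at 0 and those starting at
        -- 1. It cancels in the difference `j ∸ i`, which is positive and below `p`.
        products-distinct : ∀ e {i j} → i < j → j < 2 + (u + v) →
                            a ∙ d ^ (e + i) ∙ b ≉ a ∙ d ^ (e + j) ∙ b
        products-distinct e {i} {j} i<j j< eq = d≉ε (small-exponent⇒≈ε
          (m<n⇒0<n∸m i<j) (≤-<-trans (m∸n≤m j i) (<-trans j< bound))
          (subst (λ h → d ^ h ≈ ε) ([m+n]∸[m+o]≡n∸o e j i)
            (^-≈⇒^-∸≈ε d (+-monoʳ-≤ e (<⇒≤ i<j))
              (∙-cancelˡ a _ _ (∙-cancelʳ b _ _ eq)))))

        -- If `a ≉ b`, the exponent 0 joins the interior ones, and the exponents `0` to
        -- `1 + (u + v)` already give `2 + (u + v)` distinct members.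
        first-endpoints : ∀ {N} → HasCardinality (subsetSetoid AB) N → N < 2 + (u + v) → a ≈ b
        first-endpoints card N< = decidable-stable (a ≈? b) λ a≉b →
          let first∈ = product∈ 0 0 z<s z<s λ eq →
                a≉b (≈-trans (≈-sym (identityʳ a)) (≈-trans eq (identityˡ b)))
          in contradiction
            (distinct-members⇒≤-card card (λ i → a ∙ d ^ i ∙ b)
              (λ { {zero} _ → first∈ ; {suc i} i< → interior∈ (s≤s⁻¹ (s≤s⁻¹ i<)) })
              (products-distinct 0))
            (<⇒≱ N<)

        -- The same count, shifted by one: the exponents now run from 1 to `2 + (u + v)`, the top
        -- one being `suc u + suc v`, the product of the last endpoints.
        last-endpoints : ∀ {N} → HasCardinality (subsetSetoid AB) N → N < 2 + (u + v) →
                         a ∙ d ^ suc u ≈ d ^ suc v ∙ b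
        last-endpoints card N< = decidable-stable (_ ≈? _) λ ≉ → contradiction
          (distinct-members⇒≤-card card (λ i → a ∙ d ^ suc i ∙ b) (member ≉)
            (products-distinct 1))
          (<⇒≱ N<)
          where
          member : a ∙ d ^ suc u ≉ d ^ suc v ∙ b →
                   ∀ {i} → i < 2 + (u + v) → AB (a ∙ d ^ suc i ∙ b)
          member ≉ i< with m≤n⇒m<n∨m≡n (s≤s⁻¹ i<)
          ... | inj₁ i<1+u+v = interior∈ (s≤s⁻¹ i<1+u+v)
          ... | inj₂ refl    = subst (λ m → AB (a ∙ d ^ suc m ∙ b)) (+-suc u v)
                (product∈ (suc u) (suc v) ≤-refl ≤-refl ≉)

theorem6p1 : {c ℓ ℓ₁ ℓ₂ : Level} (G : Group c ℓ) →
    let open Group G in let open GroupSubsets G in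
    (n p : ℕ) → HasCardinality setoid n → IsSmallestPrimeDivisor p n →
    (A : Pred Carrier ℓ₁) (B : Pred Carrier ℓ₂) (k l : ℕ) →
    HasCardinality (subsetSetoid A) k →
    HasCardinality (subsetSetoid B) l →
    3 ≤ k → 3 ≤ l → k + l ∸ 2 < p →
    (a b d : Carrier) →
    A ≐ RightProgression a d k →
    B ≐ LeftProgression d b l →
    HasCardinality (subsetSetoid (RestrictedProduct A B)) (k + l ∸ 3) →
    (a ≈ b) × (a ∙ (d ^ (k ∸ 1)) ≈ (d ^ (l ∸ 1)) ∙ b)
theorem6p1 G n p finite p-least A B (2+ u) (2+ v) cardA cardB (s≤s (s≤s _)) (s≤s (s≤s _))
           bound a b d A≐ B≐ cardAB =
  first-endpoints G finite p-least bound′ d≉ε (proj₂ A≐) (proj₂ B≐) cardAB N< ,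
  last-endpoints G finite p-least bound′ d≉ε (proj₂ A≐) (proj₂ B≐) cardAB N<
  where
  d≉ε = ratio≉ε G cardA A≐

  k+l≡ : u + 2+ v ≡ 2 + (u + v)
  k+l≡ = ≡.trans (+-suc u (suc v)) (cong suc (+-suc u v))

  bound′ : 2 + (u + v) < p
  bound′ = subst (_< p) k+l≡ bound

  -- Here `k + l ∸ 3` is `1 + (u + v)`, one less than the number of exponents in either count.
  N< : u + 2+ v ∸ 1 < 2 + (u + v)
  N< = subst (λ h → h ∸ 1 < 2 + (u + v)) (≡.sym k+l≡) ≤-refl
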